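{- Let $u,v\in\mathbb{N}$ and let $A$ be a $u\times v$ matrix with entries from $\mathbb{Z}[i]$ which is image partition regular over $\mathbb{Z}[i]$. If $C$ is thick in $\mathbb{Z}[i]$, then $W=\{\vec{z}\in(\mathbb{Z}[i]\setminus\{0\})^{v}:A\vec{z}\in C^{u}\}$ is thick in $(\mathbb{Z}[i])^{v}$.
   Context: $\mathbb{Z}[i]$ is the ring of Gaussian integers; $C^u$ is the set of vectors all of whose $u$ entries lie in $C$. A $u\times v$ matrix $A$ with entries in $\mathbb{Z}[i]$ is image partition regular over $\mathbb{Z}[i]$ if for every $k\in\mathbb{N}$ and every partition $\mathbb{Z}[i]\setminus\{0\}=\bigcup_{j=1}^k D_j$ there are $j$ and $\vec{x}\in(\mathbb{Z}[i]\setminus\{0\})^v$ with $A\vec{x}\in D_j^u$. In a commutative semigroup $(S,+)$, $B\subseteq S$ is thick if for every finite nonempty $F\subseteq S$ there is $x\in S$ with $F+x\subseteq B$ (equivalently, $B$ meets every syndetic set, i.e. every $B'$ with $S=\bigcup_{t\in G}(-t+B')$ for some finite nonempty $G\subseteq S$). -}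

module Defs where

open import Data.Nat using (ℕ; zero; suc)
open import Data.Fin using (Fin; zero; suc)
open import Data.Integer as ℤ using (ℤ)
open import Data.List using (List; [])
open import Data.List.Relation.Unary.All using (All)
open import Data.Product using (∃; _×_)
open import Relation.Binary.PropositionalEquality using (_≡_; _≢_)

record ℤ[i] : Set where
  constructor _+_i
  field
    re : ℤ
    im : ℤ
open ℤ[i] public

0ᵍ : ℤ[i]
0ᵍ = (ℤ.+ 0) + (ℤ.+ 0) i

_+ᵍ_ : ℤ[i] → ℤ[i] → ℤ[i]
(a + b i) +ᵍ (c + d i) = (a ℤ.+ c) + (b ℤ.+ d) i

_*ᵍ_ : ℤ[i] → ℤ[i] → ℤ[i]
(a + b i) *ᵍ (c + d i) = (a ℤ.* c ℤ.- b ℤ.* d) + (a ℤ.* d ℤ.+ b ℤ.* c) i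

sumᵍ : ∀ n → (Fin n → ℤ[i]) → ℤ[i]
sumᵍ zero    f = 0ᵍ
sumᵍ (suc n) f = f zero +ᵍ sumᵍ n (λ k → f (suc k))

Matrix : ℕ → ℕ → Set
Matrix u v = Fin u → Fin v → ℤ[i]

Vecᵍ : ℕ → Set
Vecᵍ v = Fin v → ℤ[i]

_·_ : ∀ {u v} → Matrix u v → Vecᵍ v → Vecᵍ u
(A · x) r = sumᵍ _ (λ s → A r s *ᵍ x s)

_+ᵛ_ : ∀ {v} → Vecᵍ v → Vecᵍ v → Vecᵍ v
(x +ᵛ y) s = x s +ᵍ y s

-- A partition ℤ[i]∖{0} = D₁ ∪ … ∪ D_k is given by a colouring
-- c : ℤ[i] → Fin k (the value at 0 is irrelevant); D_j = {z ≠ 0 : c z ≡ j}.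
ImagePartitionRegular : ∀ {u v} → Matrix u v → Set
ImagePartitionRegular {u} {v} A =
  (k : ℕ) (c : ℤ[i] → Fin k) →
  ∃ λ (j : Fin k) → ∃ λ (x : Vecᵍ v) →
    (∀ s → x s ≢ 0ᵍ) × (∀ r → (A · x) r ≢ 0ᵍ × c ((A · x) r) ≡ j)

-- B ⊆ S thick in commutative semigroup (S,_∙_): every finite nonempty F ⊆ S
-- has a translate F + x contained in B. Finite sets are given by (nonempty) lists.
Thick : {S : Set} → (S → S → S) → (S → Set) → Set
Thick {S} _∙_ B = (F : List S) → F ≢ [] → ∃ λ (x : S) → All (λ f → B (f ∙ x)) F

{-# OPTIONS --safe #-}

-- Colour z = 3ᵏ y (3 ∤ y) by k modulo N and y modulo 3ᴺ.  In a monochromatic image y = A x the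
-- 3-adic valuations of the entries order the rows into levels.  For a level k, dividing by 3ᵏ
-- shows that, modulo 3ᴺ, a unit multiple of the vector that is 1 on level k and 0 on higher levels
-- lies in the image of A: lower levels are ignored, and valuations above k are at least k + N,
-- being congruent to k modulo N.  For N large this forces an exact solution:
-- by linear algebra the only obstruction is an integral functional φ killing the columns but not
-- this vector, and finitely many such φ are considered.  So each level has a vector w with A w = d ≠ 0
-- on the level and A w = 0 above it.  Going down through the levels, one adds a multiple m w
-- at each step: thickness provides m that puts all rows of the level into C, and taking m large
-- keeps the coordinates nonzero.
module Submission where

open import Defs
open Defs using () renaming (_+ᵍ_ to infixl 6 _⊕_; _*ᵍ_ to infixl 7 _⊗_)
open import Algebra.Bundles using (CommutativeRing)
open import Data.Fin using (Fin; zero; suc; toℕ; fromℕ<; combine)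
import Data.Fin.Properties as Fin
open import Data.Integer as ℤ using (ℤ; ∣_∣; +_)
import Data.Integer.Divisibility.Signed as ℤ
import Data.Integer.DivMod as ℤ
import Data.Integer.Properties as ℤ
import Data.Integer.Tactic.RingSolver as ℤ-Ring
open import Data.List using (List; []; _∷_; allFin; cartesianProductWith; map; upTo)
import Data.List.Extrema.Nat as List
open import Data.List.Membership.Propositional using (_∈_)
open import Data.List.Membership.Propositional.Properties using (∈-cartesianProductWith⁺; ∈-allFin; ∈-map⁺; ∈-upTo⁺)
open import Data.List.Relation.Unary.All as All using (All)
open import Data.List.Relation.Unary.Any using (here; there)
open import Data.Maybe using (Maybe; just; nothing)
open import Data.Nat as ℕ using (ℕ; zero; suc; _≤_; _<_; z≤n; s≤s; NonZero)
import Data.Nat.Divisibility as ℕ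
import Data.Nat.DivMod as ℕ
open import Data.Nat.Primality using (prime?; euclidsLemma)
import Data.Nat.Properties as ℕ
open import Data.Product using (∃; ∃₂; _×_; _,_; proj₁; proj₂; map₂; uncurry)
open import Data.Sum as ⊎ using (_⊎_; inj₁; inj₂; [_,_]′)
open import Data.Vec using (Vec; []; _∷_; lookup; tabulate)
open import Data.Vec.Properties using (lookup∘tabulate)
open import Function using (_∘_; id)
open import Level using (0ℓ)
open import Relation.Binary using (DecidableEquality; Tri; tri<; tri≈; tri>)
open import Relation.Binary.PropositionalEquality
open import Relation.Nullary using (¬_; Dec; yes; no; contradiction; ¬?)
open import Relation.Nullary.Decidable using (decidable-stable; from-yes; map′; _×-dec_; _→-dec_)
open import Tactic.RingSolver using (solve-∀)
open import Tactic.RingSolver.Core.AlmostCommutativeRing using (AlmostCommutativeRing; fromCommutativeRing)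

-- The ring ℤ[i] and its norm

1ᵍ : ℤ[i]
1ᵍ = (ℤ.+ 1) + (ℤ.+ 0) i

infix 8 ⊖_
⊖_ : ℤ[i] → ℤ[i]
⊖ (a + b i) = (ℤ.- a) + (ℤ.- b) i

_≟ᵍ_ : DecidableEquality ℤ[i]
x ≟ᵍ y = map′ (λ (p , q) → cong₂ _+_i p q) (λ e → cong re e , cong im e)
         ((re x ℤ.≟ re y) ×-dec (im x ℤ.≟ im y))

ring : CommutativeRing 0ℓ 0ℓ
ring = record
  { Carrier = ℤ[i] ; _≈_ = _≡_ ; _+_ = _⊕_ ; _*_ = _⊗_ ; -_ = ⊖_ ; 0# = 0ᵍ ; 1# = 1ᵍ
  ; isCommutativeRing = record
    { isRing = record
      { +-isAbelianGroup = record
        { isGroup = record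
          { isMonoid = record
            { isSemigroup = record
              { isMagma = record { isEquivalence = isEquivalence ; ∙-cong = cong₂ _⊕_ }
              ; assoc = λ x y z → cong₂ _+_i (ℤ.+-assoc (re x) (re y) (re z)) (ℤ.+-assoc (im x) (im y) (im z)) }
            ; identity = (λ x → cong₂ _+_i (ℤ.+-identityˡ (re x)) (ℤ.+-identityˡ (im x)))
                       , (λ x → cong₂ _+_i (ℤ.+-identityʳ (re x)) (ℤ.+-identityʳ (im x))) }
          ; inverse = (λ x → cong₂ _+_i (ℤ.+-inverseˡ (re x)) (ℤ.+-inverseˡ (im x)))
                    , (λ x → cong₂ _+_i (ℤ.+-inverseʳ (re x)) (ℤ.+-inverseʳ (im x)))
          ; ⁻¹-cong = cong ⊖_ }
        ; comm = λ x y → cong₂ _+_i (ℤ.+-comm (re x) (re y)) (ℤ.+-comm (im x) (im y)) }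
      ; *-cong = cong₂ _⊗_
      ; *-assoc = λ (a + b i) (c + d i) (e + f i) → cong₂ _+_i (assoc-re a b c d e f) (assoc-im a b c d e f)
      ; *-identity = (λ (a + b i) → cong₂ _+_i (idˡ-re a b) (idˡ-im a b))
                   , (λ (a + b i) → cong₂ _+_i (idʳ-re a b) (idʳ-im a b))
      ; distrib = (λ (a + b i) (c + d i) (e + f i) → cong₂ _+_i (distribˡ-re a b c d e f) (distribˡ-im a b c d e f))
                , (λ (a + b i) (c + d i) (e + f i) → cong₂ _+_i (distribʳ-re a b c d e f) (distribʳ-im a b c d e f)) }
    ; *-comm = λ (a + b i) (c + d i) → cong₂ _+_i (comm-re a b c d) (comm-im a b c d) } }
  where
  open import Data.Integer using (_+_; _*_; _-_; +_)
  assoc-re : ∀ a b c d e f → (a * c - b * d) * e - (a * d + b * c) * f ≡ a * (c * e - d * f) - b * (c * f + d * e)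
  assoc-re = ℤ-Ring.solve-∀
  assoc-im : ∀ a b c d e f → (a * c - b * d) * f + (a * d + b * c) * e ≡ a * (c * f + d * e) + b * (c * e - d * f)
  assoc-im = ℤ-Ring.solve-∀
  idˡ-re : ∀ a b → + 1 * a - + 0 * b ≡ a
  idˡ-re = ℤ-Ring.solve-∀
  idˡ-im : ∀ a b → + 1 * b + + 0 * a ≡ b
  idˡ-im = ℤ-Ring.solve-∀
  idʳ-re : ∀ a b → a * + 1 - b * + 0 ≡ a
  idʳ-re = ℤ-Ring.solve-∀
  idʳ-im : ∀ a b → a * + 0 + b * + 1 ≡ b
  idʳ-im = ℤ-Ring.solve-∀
  distribˡ-re : ∀ a b c d e f → a * (c + e) - b * (d + f) ≡ (a * c - b * d) + (a * e - b * f)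
  distribˡ-re = ℤ-Ring.solve-∀
  distribˡ-im : ∀ a b c d e f → a * (d + f) + b * (c + e) ≡ (a * d + b * c) + (a * f + b * e)
  distribˡ-im = ℤ-Ring.solve-∀
  distribʳ-re : ∀ a b c d e f → (c + e) * a - (d + f) * b ≡ (c * a - d * b) + (e * a - f * b)
  distribʳ-re = ℤ-Ring.solve-∀
  distribʳ-im : ∀ a b c d e f → (c + e) * b + (d + f) * a ≡ (c * b + d * a) + (e * b + f * a)
  distribʳ-im = ℤ-Ring.solve-∀
  comm-re : ∀ a b c d → a * c - b * d ≡ c * a - d * b
  comm-re = ℤ-Ring.solve-∀
  comm-im : ∀ a b c d → a * d + b * c ≡ c * b + d * a
  comm-im = ℤ-Ring.solve-∀

almostRing : AlmostCommutativeRing 0ℓ 0ℓ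
almostRing = fromCommutativeRing ring isZero
  where
  isZero : (x : ℤ[i]) → Maybe (0ᵍ ≡ x)
  isZero x with 0ᵍ ≟ᵍ x
  ... | yes p = just p
  ... | no _ = nothing

open CommutativeRing ring using (zeroˡ; zeroʳ; *-identityˡ; +-identityˡ; +-assoc; *-comm; *-assoc)

⟦_⟧ : ℤ → ℤ[i]
⟦ n ⟧ = n + (ℤ.+ 0) i

⟦⟧-* : ∀ m n → ⟦ m ℤ.* n ⟧ ≡ ⟦ m ⟧ ⊗ ⟦ n ⟧
⟦⟧-* m n = cong₂ _+_i (re-eq m n) (im-eq m n)
  where
  re-eq : ∀ m n → m ℤ.* n ≡ m ℤ.* n ℤ.- (+ 0) ℤ.* (+ 0)
  re-eq = ℤ-Ring.solve-∀
  im-eq : ∀ m n → + 0 ≡ m ℤ.* (+ 0) ℤ.+ (+ 0) ℤ.* n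
  im-eq = ℤ-Ring.solve-∀

⟦⟧-⊗ : ∀ n a b → ⟦ n ⟧ ⊗ (a + b i) ≡ (n ℤ.* a) + (n ℤ.* b) i
⟦⟧-⊗ n a b = cong₂ _+_i (re-eq n a b) (im-eq n a b)
  where
  re-eq : ∀ n a b → n ℤ.* a ℤ.- (+ 0) ℤ.* b ≡ n ℤ.* a
  re-eq = ℤ-Ring.solve-∀
  im-eq : ∀ n a b → n ℤ.* b ℤ.+ (+ 0) ℤ.* a ≡ n ℤ.* b
  im-eq = ℤ-Ring.solve-∀

norm : ℤ[i] → ℕ
norm (a + b i) = ∣ a ∣ ℕ.* ∣ a ∣ ℕ.+ ∣ b ∣ ℕ.* ∣ b ∣

+∣i∣²≡i² : ∀ i → + (∣ i ∣ ℕ.* ∣ i ∣) ≡ i ℤ.* i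
+∣i∣²≡i² (+ n)      = ℤ.pos-* n n
+∣i∣²≡i² ℤ.-[1+ n ] = refl

+norm : ∀ z → + norm z ≡ re z ℤ.* re z ℤ.+ im z ℤ.* im z
+norm (a + b i) = cong₂ ℤ._+_ (+∣i∣²≡i² a) (+∣i∣²≡i² b)

norm-⊗ : ∀ x y → norm (x ⊗ y) ≡ norm x ℕ.* norm y
norm-⊗ x@(a + b i) y@(c + d i) = ℤ.+-injective (begin
  + norm (x ⊗ y)                                                    ≡⟨ +norm (x ⊗ y) ⟩
  re (x ⊗ y) ℤ.* re (x ⊗ y) ℤ.+ im (x ⊗ y) ℤ.* im (x ⊗ y)          ≡⟨ brahmagupta a b c d ⟩
  (a ℤ.* a ℤ.+ b ℤ.* b) ℤ.* (c ℤ.* c ℤ.+ d ℤ.* d)                   ≡⟨ cong₂ ℤ._*_ (+norm x) (+norm y) ⟨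
  + norm x ℤ.* + norm y                                             ≡⟨ ℤ.pos-* (norm x) (norm y) ⟨
  + (norm x ℕ.* norm y)                                             ∎)
  where
  open ≡-Reasoning
  brahmagupta : ∀ a b c d →
    (a ℤ.* c ℤ.- b ℤ.* d) ℤ.* (a ℤ.* c ℤ.- b ℤ.* d) ℤ.+ (a ℤ.* d ℤ.+ b ℤ.* c) ℤ.* (a ℤ.* d ℤ.+ b ℤ.* c)
    ≡ (a ℤ.* a ℤ.+ b ℤ.* b) ℤ.* (c ℤ.* c ℤ.+ d ℤ.* d)
  brahmagupta = ℤ-Ring.solve-∀

norm-⊖ : ∀ z → norm (⊖ z) ≡ norm z
norm-⊖ (a + b i) = cong₂ (λ p q → p ℕ.* p ℕ.+ q ℕ.* q) (ℤ.∣-i∣≡∣i∣ a) (ℤ.∣-i∣≡∣i∣ b)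

n≤n² : ∀ n → n ≤ n ℕ.* n
n≤n² zero    = z≤n
n≤n² (suc n) = ℕ.m≤m*n (suc n) (suc n)

∣re∣≤norm : ∀ z → ∣ re z ∣ ≤ norm z
∣re∣≤norm z = ℕ.≤-trans (n≤n² ∣ re z ∣) (ℕ.m≤m+n _ _)

∣im∣≤norm : ∀ z → ∣ im z ∣ ≤ norm z
∣im∣≤norm z = ℕ.≤-trans (n≤n² ∣ im z ∣) (ℕ.m≤n+m _ _)

norm≡0⇒≡0 : ∀ z → norm z ≡ 0 → z ≡ 0ᵍ
norm≡0⇒≡0 z eq = cong₂ _+_i (ℤ.∣i∣≡0⇒i≡0 (vanish (∣re∣≤norm z))) (ℤ.∣i∣≡0⇒i≡0 (vanish (∣im∣≤norm z)))
  where
  vanish : ∀ {m} → m ≤ norm z → m ≡ 0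
  vanish {m} le = ℕ.n≤0⇒n≡0 (subst (m ≤_) eq le)

0<norm : ∀ z → z ≢ 0ᵍ → 0 < norm z
0<norm z z≢0 = ℕ.n≢0⇒n>0 (z≢0 ∘ norm≡0⇒≡0 z)

-- The norm is multiplicative and vanishes only at 0, so the absence of zero divisors is inherited
-- from ℕ.
⊗≡0 : ∀ x y → x ⊗ y ≡ 0ᵍ → x ≡ 0ᵍ ⊎ y ≡ 0ᵍ
⊗≡0 x y eq = ⊎.map (norm≡0⇒≡0 x) (norm≡0⇒≡0 y)
  (ℕ.m*n≡0⇒m≡0∨n≡0 (norm x) (trans (sym (norm-⊗ x y)) (cong norm eq)))

⊗≢0 : ∀ {x y} → x ≢ 0ᵍ → y ≢ 0ᵍ → x ⊗ y ≢ 0ᵍ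
⊗≢0 {x} {y} x≢0 y≢0 = [ x≢0 , y≢0 ]′ ∘ ⊗≡0 x y

conj : ℤ[i] → ℤ[i]
conj (a + b i) = a + (ℤ.- b) i

-- Lets a multiple of the integer `norm z` be read as a multiple of `z`; thick sets are first
-- treated modulo integers only.
conj-⊗ : ∀ z → conj z ⊗ z ≡ ⟦ + norm z ⟧
conj-⊗ z@(a + b i) = cong₂ _+_i (trans (re-eq a b) (sym (+norm z))) (im-eq a b)
  where
  re-eq : ∀ a b → a ℤ.* a ℤ.- (ℤ.- b) ℤ.* b ≡ a ℤ.* a ℤ.+ b ℤ.* b
  re-eq = ℤ-Ring.solve-∀
  im-eq : ∀ a b → a ℤ.* b ℤ.+ (ℤ.- b) ℤ.* a ≡ + 0
  im-eq = ℤ-Ring.solve-∀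

module _ (n : ℕ) .{{_ : NonZero n}} where

  residue : ℤ[i] → ℤ[i]
  residue (a + b i) = (+ (a ℤ.%ℕ n)) + (+ (b ℤ.%ℕ n)) i

  quotient : ℤ[i] → ℤ[i]
  quotient (a + b i) = (a ℤ./ℕ n) + (b ℤ./ℕ n) i

  residue-quotient : ∀ z → z ≡ residue z ⊕ ⟦ + n ⟧ ⊗ quotient z
  residue-quotient z@(a + b i) = begin
    z
      ≡⟨ cong₂ _+_i (ℤ.a≡a%ℕn+[a/ℕn]*n a n) (ℤ.a≡a%ℕn+[a/ℕn]*n b n) ⟩
    residue z ⊕ (((a ℤ./ℕ n) ℤ.* + n) + ((b ℤ./ℕ n) ℤ.* + n) i)
      ≡⟨ cong (residue z ⊕_) (cong₂ _+_i (ℤ.*-comm (a ℤ./ℕ n) (+ n)) (ℤ.*-comm (b ℤ./ℕ n) (+ n))) ⟩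
    residue z ⊕ ((+ n ℤ.* (a ℤ./ℕ n)) + (+ n ℤ.* (b ℤ./ℕ n)) i)
      ≡⟨ cong (residue z ⊕_) (⟦⟧-⊗ (+ n) (a ℤ./ℕ n) (b ℤ./ℕ n)) ⟨
    residue z ⊕ ⟦ + n ⟧ ⊗ quotient z ∎
    where open ≡-Reasoning

  -- The residue packed into a finite type, so that it can be one component of a colour.
  residueClass : ℤ[i] → Fin (n ℕ.* n)
  residueClass (a + b i) = combine (fromℕ< (ℤ.n%ℕd<d a n)) (fromℕ< (ℤ.n%ℕd<d b n))

  residueClass⇒residue : ∀ {x y} → residueClass x ≡ residueClass y → residue x ≡ residue y
  residueClass⇒residue {a + b i} {c + d i} eq =
    let re-eq , im-eq = Fin.combine-injective _ _ _ _ eq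
    in cong₂ (λ p q → (+ p) + (+ q) i)
         (Fin.fromℕ<-injective _ _ (ℤ.n%ℕd<d a n) (ℤ.n%ℕd<d c n) re-eq)
         (Fin.fromℕ<-injective _ _ (ℤ.n%ℕd<d b n) (ℤ.n%ℕd<d d n) im-eq)

-- Divisibility by 3

3ᵍ : ℤ[i]
3ᵍ = ⟦ + 3 ⟧

infix 4 3∣_
3∣_ : ℤ[i] → Set
3∣ z = ∃ λ y → z ≡ 3ᵍ ⊗ y

3∣-components : ∀ {z} → 3 ℕ.∣ ∣ re z ∣ → 3 ℕ.∣ ∣ im z ∣ → 3∣ z
3∣-components {a + b i} 3∣a 3∣b with ℤ.∣ᵤ⇒∣ {+ 3} {a} 3∣a | ℤ.∣ᵤ⇒∣ {+ 3} {b} 3∣b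
... | ℤ.divides p refl | ℤ.divides q refl =
  (p + q i) , trans (cong₂ _+_i (ℤ.*-comm p (+ 3)) (ℤ.*-comm q (+ 3))) (sym (⟦⟧-⊗ (+ 3) p q))

3∣-components⁻ : ∀ {z} → 3∣ z → 3 ℕ.∣ ∣ re z ∣ × 3 ℕ.∣ ∣ im z ∣
3∣-components⁻ ((p + q i) , refl) =
    subst (λ t → 3 ℕ.∣ ∣ re t ∣) (sym (⟦⟧-⊗ (+ 3) p q)) (multiple p)
  , subst (λ t → 3 ℕ.∣ ∣ im t ∣) (sym (⟦⟧-⊗ (+ 3) p q)) (multiple q)
  where
  multiple : ∀ p → 3 ℕ.∣ ∣ + 3 ℤ.* p ∣
  multiple p = subst (3 ℕ.∣_) (sym (ℤ.abs-* (+ 3) p)) (ℕ.m∣m*n ∣ p ∣)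

3∣?_ : ∀ z → Dec (3∣ z)
3∣? z = map′ (uncurry 3∣-components) 3∣-components⁻ ((3 ℕ.∣? ∣ re z ∣) ×-dec (3 ℕ.∣? ∣ im z ∣))

-- Squares modulo 3 are 0 or 1, so two of them sum to 0 only trivially; all nine cases are decided
-- by computation. This is what keeps 3 prime in ℤ[i].
squares-mod-3 : (r s : Fin 3) → (toℕ r ℕ.* toℕ r ℕ.+ toℕ s ℕ.* toℕ s) ℕ.% 3 ≡ 0 → toℕ r ≡ 0 × toℕ s ≡ 0
squares-mod-3 = from-yes (Fin.all? {3} λ r → Fin.all? {3} λ s →
  ((toℕ r ℕ.* toℕ r ℕ.+ toℕ s ℕ.* toℕ s) ℕ.% 3 ℕ.≟ 0) →-dec ((toℕ r ℕ.≟ 0) ×-dec (toℕ s ℕ.≟ 0)))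

3∣a²+b² : ∀ a b → 3 ℕ.∣ a ℕ.* a ℕ.+ b ℕ.* b → 3 ℕ.∣ a × 3 ℕ.∣ b
3∣a²+b² a b 3∣ =
  let a≡0 , b≡0 = squares-mod-3 (a ℕ.mod 3) (b ℕ.mod 3) eq
  in ℕ.m%n≡0⇒n∣m a 3 (trans (sym (toℕ-mod a)) a≡0) , ℕ.m%n≡0⇒n∣m b 3 (trans (sym (toℕ-mod b)) b≡0)
  where
  toℕ-mod : ∀ a → toℕ (a ℕ.mod 3) ≡ a ℕ.% 3
  toℕ-mod a = Fin.toℕ-fromℕ< (ℕ.m%n<n a 3)
  open ≡-Reasoning
  eq : (toℕ (a ℕ.mod 3) ℕ.* toℕ (a ℕ.mod 3) ℕ.+ toℕ (b ℕ.mod 3) ℕ.* toℕ (b ℕ.mod 3)) ℕ.% 3 ≡ 0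
  eq = begin
    (toℕ (a ℕ.mod 3) ℕ.* toℕ (a ℕ.mod 3) ℕ.+ toℕ (b ℕ.mod 3) ℕ.* toℕ (b ℕ.mod 3)) ℕ.% 3
      ≡⟨ cong₂ (λ r s → (r ℕ.* r ℕ.+ s ℕ.* s) ℕ.% 3) (toℕ-mod a) (toℕ-mod b) ⟩
    ((a ℕ.% 3) ℕ.* (a ℕ.% 3) ℕ.+ (b ℕ.% 3) ℕ.* (b ℕ.% 3)) ℕ.% 3
      ≡⟨ ℕ.%-distribˡ-+ ((a ℕ.% 3) ℕ.* (a ℕ.% 3)) ((b ℕ.% 3) ℕ.* (b ℕ.% 3)) 3 ⟩
    ((a ℕ.% 3) ℕ.* (a ℕ.% 3) ℕ.% 3 ℕ.+ (b ℕ.% 3) ℕ.* (b ℕ.% 3) ℕ.% 3) ℕ.% 3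
      ≡⟨ cong₂ (λ r s → (r ℕ.+ s) ℕ.% 3) (ℕ.%-distribˡ-* a a 3) (ℕ.%-distribˡ-* b b 3) ⟨
    (a ℕ.* a ℕ.% 3 ℕ.+ b ℕ.* b ℕ.% 3) ℕ.% 3
      ≡⟨ ℕ.%-distribˡ-+ (a ℕ.* a) (b ℕ.* b) 3 ⟨
    (a ℕ.* a ℕ.+ b ℕ.* b) ℕ.% 3
      ≡⟨ ℕ.n∣m⇒m%n≡0 _ 3 3∣ ⟩
    0 ∎

3∣norm⇒3∣ : ∀ z → 3 ℕ.∣ norm z → 3∣ z
3∣norm⇒3∣ (a + b i) = uncurry 3∣-components ∘ 3∣a²+b² ∣ a ∣ ∣ b ∣

-- Passing to norms reduces this to Euclid's lemma in ℕ: 3 divides a norm only if it divides both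
-- components.
3-prime : ∀ x y → 3∣ x ⊗ y → 3∣ x ⊎ 3∣ y
3-prime x y (w , eq) = ⊎.map (3∣norm⇒3∣ x) (3∣norm⇒3∣ y)
  (euclidsLemma (norm x) (norm y) (from-yes (prime? 3)) 3∣norms)
  where
  3∣norms : 3 ℕ.∣ norm x ℕ.* norm y
  3∣norms = subst (3 ℕ.∣_) (trans (sym (norm-⊗ 3ᵍ w)) (trans (cong norm (sym eq)) (norm-⊗ x y)))
    (ℕ.∣m⇒∣m*n (norm w) (ℕ.divides 3 refl))

3^_ : ℕ → ℤ[i]
3^ k = ⟦ + (3 ℕ.^ k) ⟧

3^-+ : ∀ m n → 3^ (m ℕ.+ n) ≡ 3^ m ⊗ 3^ n
3^-+ m n = trans (cong ⟦_⟧ (trans (cong +_ (ℕ.^-distribˡ-+-* 3 m n)) (ℤ.pos-* (3 ℕ.^ m) (3 ℕ.^ n))))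
  (⟦⟧-* (+ (3 ℕ.^ m)) (+ (3 ℕ.^ n)))

3^≢0 : ∀ k → 3^ k ≢ 0ᵍ
3^≢0 k eq = ℕ.≢-nonZero⁻¹ _ {{ℕ.m^n≢0 3 k}} (ℤ.+-injective (cong re eq))

Factored : ℤ[i] → Set
Factored z = ∃₂ λ k y → z ≡ 3^ k ⊗ y × ¬ 3∣ y

-- Repeated division by 3. Each division of a nonzero number lowers the norm by the factor 9, so a
-- bound above the norm serves as fuel.
factor : ∀ z → z ≡ 0ᵍ ⊎ Factored z
factor z = go (suc (norm z)) z ℕ.≤-refl
  where
  go : ∀ n z → norm z < n → z ≡ 0ᵍ ⊎ Factored z
  go (suc n) z (s≤s norm≤n) with z ≟ᵍ 0ᵍ | 3∣? z
  ... | yes z≡0 | _ = inj₁ z≡0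
  ... | no z≢0 | no ¬3∣z = inj₂ (0 , z , sym (*-identityˡ z) , ¬3∣z)
  ... | no z≢0 | yes (y , refl) with go n y (ℕ.<-≤-trans norm-decreases norm≤n)
    where
    norm-decreases : norm y < norm (3ᵍ ⊗ y)
    norm-decreases = subst (norm y <_) (sym (norm-⊗ 3ᵍ y))
      (subst (norm y <_) (ℕ.*-comm (norm y) 9) (ℕ.m<m*n (norm y) 9 {{ℕ.>-nonZero (0<norm y λ { refl → z≢0 refl })}} (s≤s (s≤s z≤n))))
  ...   | inj₁ refl = contradiction refl z≢0
  ...   | inj₂ (k , x , refl , ¬3∣x) =
    inj₂ (suc k , x , trans (assoc 3ᵍ (3^ k) x) (cong (_⊗ x) (sym (3^-+ 1 k))) , ¬3∣x)
    where
    assoc : ∀ a b c → a ⊗ (b ⊗ c) ≡ a ⊗ b ⊗ c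
    assoc = solve-∀ almostRing

-- Linear functionals and solvability

sum-cong : ∀ n {f g : Fin n → ℤ[i]} → (∀ k → f k ≡ g k) → sumᵍ n f ≡ sumᵍ n g
sum-cong zero    eq = refl
sum-cong (suc n) eq = cong₂ _⊕_ (eq zero) (sum-cong n (eq ∘ suc))

sum-linear : ∀ n (f g : Fin n → ℤ[i]) c d →
  sumᵍ n (λ k → c ⊗ f k ⊕ d ⊗ g k) ≡ c ⊗ sumᵍ n f ⊕ d ⊗ sumᵍ n g
sum-linear zero    f g c d = sym (rearrange c d)
  where
  rearrange : ∀ c d → c ⊗ 0ᵍ ⊕ d ⊗ 0ᵍ ≡ 0ᵍ
  rearrange = solve-∀ almostRing
sum-linear (suc n) f g c d = trans
  (cong (c ⊗ f zero ⊕ d ⊗ g zero ⊕_) (sum-linear n (f ∘ suc) (g ∘ suc) c d))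
  (rearrange c d (f zero) (g zero) (sumᵍ n (f ∘ suc)) (sumᵍ n (g ∘ suc)))
  where
  rearrange : ∀ c d x y s t → c ⊗ x ⊕ d ⊗ y ⊕ (c ⊗ s ⊕ d ⊗ t) ≡ c ⊗ (x ⊕ s) ⊕ d ⊗ (y ⊕ t)
  rearrange = solve-∀ almostRing

sum-⊗ : ∀ n c (f : Fin n → ℤ[i]) → sumᵍ n (λ k → c ⊗ f k) ≡ c ⊗ sumᵍ n f
sum-⊗ zero    c f = sym (zeroʳ c)
sum-⊗ (suc n) c f = trans (cong (c ⊗ f zero ⊕_) (sum-⊗ n c (f ∘ suc))) (factor-out c (f zero) (sumᵍ n (f ∘ suc)))
  where
  factor-out : ∀ c x y → c ⊗ x ⊕ c ⊗ y ≡ c ⊗ (x ⊕ y)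
  factor-out = solve-∀ almostRing

-- Given as a linear map rather than by coefficients, so that pulling back along an elimination step
-- is mere composition.
record Functional (u : ℕ) : Set where
  field
    app        : Vecᵍ u → ℤ[i]
    app-cong   : ∀ {x y} → (∀ r → x r ≡ y r) → app x ≡ app y
    app-linear : ∀ c d x y → app (λ r → c ⊗ x r ⊕ d ⊗ y r) ≡ c ⊗ app x ⊕ d ⊗ app y
open Functional

module _ {u : ℕ} where

  evalAt : Fin u → Functional u
  evalAt r = record { app = λ x → x r ; app-cong = λ eq → eq r ; app-linear = λ _ _ _ _ → refl }

  app-0 : ∀ (φ : Functional u) x → (∀ r → x r ≡ 0ᵍ) → app φ x ≡ 0ᵍ
  app-0 φ x x≡0 = begin
    app φ x                            ≡⟨ app-cong φ (λ r → trans (x≡0 r) (sym (annihilate (x r) (x r)))) ⟩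
    app φ (λ r → 0ᵍ ⊗ x r ⊕ 0ᵍ ⊗ x r)  ≡⟨ app-linear φ 0ᵍ 0ᵍ x x ⟩
    0ᵍ ⊗ app φ x ⊕ 0ᵍ ⊗ app φ x        ≡⟨ annihilate (app φ x) (app φ x) ⟩
    0ᵍ                                 ∎
    where
    open ≡-Reasoning
    annihilate : ∀ x y → 0ᵍ ⊗ x ⊕ 0ᵍ ⊗ y ≡ 0ᵍ
    annihilate = solve-∀ almostRing

  column : ∀ {v} → Matrix u v → Fin v → Vecᵍ u
  column M s r = M r s

  app-columns : ∀ (φ : Functional u) v (M : Matrix u v) →
    (∀ s → app φ (column M s) ≡ 0ᵍ) → ∀ x → app φ (M · x) ≡ 0ᵍ
  app-columns φ zero    M kills x = app-0 φ (M · x) (λ _ → refl)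
  app-columns φ (suc v) M kills x = begin
    app φ (M · x)                                              ≡⟨ app-cong φ (λ r → unit (M r zero) (x zero) (tail r)) ⟩
    app φ (λ r → x zero ⊗ column M zero r ⊕ 1ᵍ ⊗ tail r)       ≡⟨ app-linear φ (x zero) 1ᵍ (column M zero) tail ⟩
    x zero ⊗ app φ (column M zero) ⊕ 1ᵍ ⊗ app φ tail           ≡⟨ cong₂ (λ p q → x zero ⊗ p ⊕ 1ᵍ ⊗ q) (kills zero)
                                                                    (app-columns φ v (λ r → M r ∘ suc) (kills ∘ suc) (x ∘ suc)) ⟩
    x zero ⊗ 0ᵍ ⊕ 1ᵍ ⊗ 0ᵍ                                      ≡⟨ vanish (x zero) ⟩
    0ᵍ                                                         ∎
    where
    open ≡-Reasoning
    tail : Vecᵍ u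
    tail = (λ r → M r ∘ suc) · (x ∘ suc)
    unit : ∀ m x t → m ⊗ x ⊕ t ≡ x ⊗ m ⊕ 1ᵍ ⊗ t
    unit = solve-∀ almostRing
    vanish : ∀ x → x ⊗ 0ᵍ ⊕ 1ᵍ ⊗ 0ᵍ ≡ 0ᵍ
    vanish = solve-∀ almostRing

  -- The factor `d` clears denominators: this is solvability of `M w = b` over the fraction field,
  -- expressed without fractions.
  Solvable : ∀ {v} → Matrix u v → Vecᵍ u → Set
  Solvable {v} M b = ∃₂ λ (d : ℤ[i]) (w : Vecᵍ v) → d ≢ 0ᵍ × (∀ r → (M · w) r ≡ d ⊗ b r)

  Obstructed : ∀ {v} → Matrix u v → Vecᵍ u → Set
  Obstructed M b = ∃ λ (φ : Functional u) → (∀ s → app φ (column M s) ≡ 0ᵍ) × app φ b ≢ 0ᵍ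

  zero? : (x : Vecᵍ u) → (∀ r → x r ≡ 0ᵍ) ⊎ ∃ λ r → x r ≢ 0ᵍ
  zero? x with Fin.any? (λ r → ¬? (x r ≟ᵍ 0ᵍ))
  ... | yes nonzero = inj₂ nonzero
  ... | no  none    = inj₁ λ r → decidable-stable (x r ≟ᵍ 0ᵍ) λ x≢0 → none (r , x≢0)

  -- Fraction-free Gaussian elimination of the first column, with pivot in row p.
  module Eliminate {v} (M : Matrix u (suc v)) (p : Fin u) where

    α : ℤ[i]
    α = M p zero

    -- Sends the first column to 0 and makes the pivot coordinate vanish, without dividing by `α`.
    reduce : Vecᵍ u → Vecᵍ u
    reduce x r = α ⊗ x r ⊕ ⊖ x p ⊗ M r zero

    reduced : Matrix u v
    reduced r s = reduce (column M (suc s)) r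

    pullback : Functional u → Functional u
    pullback φ = record
      { app = λ x → app φ (reduce x)
      ; app-cong = λ {x} {y} eq → app-cong φ λ r → cong₂ (λ s t → α ⊗ s ⊕ ⊖ t ⊗ M r zero) (eq r) (eq p)
      ; app-linear = λ c d x y → trans
          (app-cong φ λ r → rearrange α (M r zero) c d (x r) (x p) (y r) (y p))
          (app-linear φ c d (reduce x) (reduce y)) }
      where
      rearrange : ∀ α a c d x x′ y y′ →
        α ⊗ (c ⊗ x ⊕ d ⊗ y) ⊕ ⊖ (c ⊗ x′ ⊕ d ⊗ y′) ⊗ a ≡ c ⊗ (α ⊗ x ⊕ ⊖ x′ ⊗ a) ⊕ d ⊗ (α ⊗ y ⊕ ⊖ y′ ⊗ a)
      rearrange = solve-∀ almostRing

    pullback-pivot : ∀ φ → app (pullback φ) (column M zero) ≡ 0ᵍ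
    pullback-pivot φ = app-0 φ (reduce (column M zero)) λ r → cancel α (M r zero)
      where
      cancel : ∀ α a → α ⊗ a ⊕ ⊖ α ⊗ a ≡ 0ᵍ
      cancel = solve-∀ almostRing

    tail : Vecᵍ v → Vecᵍ u
    tail w r = sumᵍ v λ s → M r (suc s) ⊗ w s

    reduced-· : ∀ w r → (reduced · w) r ≡ α ⊗ tail w r ⊕ ⊖ M r zero ⊗ tail w p
    reduced-· w r = trans
      (sum-cong v λ s → rearrange α (M r zero) (M r (suc s)) (M p (suc s)) (w s))
      (sum-linear v (λ s → M r (suc s) ⊗ w s) (λ s → M p (suc s) ⊗ w s) α (⊖ M r zero))
      where
      rearrange : ∀ α a m m′ w → (α ⊗ m ⊕ ⊖ m′ ⊗ a) ⊗ w ≡ α ⊗ (m ⊗ w) ⊕ ⊖ a ⊗ (m′ ⊗ w)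
      rearrange = solve-∀ almostRing

    -- The first coordinate is chosen so that the pivot row holds: there `α ⊗ tail w p` cancels and
    -- `d ⊗ α ⊗ b p` remains.
    lift : Vecᵍ u → ℤ[i] → Vecᵍ v → Vecᵍ (suc v)
    lift b d w zero    = d ⊗ b p ⊕ ⊖ tail w p
    lift b d w (suc s) = α ⊗ w s

    lift-solves : ∀ b d w → (∀ r → (reduced · w) r ≡ d ⊗ reduce b r) →
      ∀ r → (M · lift b d w) r ≡ d ⊗ α ⊗ b r
    lift-solves b d w eq r = begin
      a ⊗ (d ⊗ b p ⊕ ⊖ tail w p) ⊕ sumᵍ v (λ s → M r (suc s) ⊗ (α ⊗ w s))
        ≡⟨ cong (a ⊗ (d ⊗ b p ⊕ ⊖ tail w p) ⊕_) (trans
             (sum-cong v λ s → commute (M r (suc s)) α (w s))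
             (sum-⊗ v α λ s → M r (suc s) ⊗ w s)) ⟩
      a ⊗ (d ⊗ b p ⊕ ⊖ tail w p) ⊕ α ⊗ tail w r
        ≡⟨ rearrange a d (b p) (tail w p) α (tail w r) ⟩
      a ⊗ d ⊗ b p ⊕ (α ⊗ tail w r ⊕ ⊖ a ⊗ tail w p)
        ≡⟨ cong (a ⊗ d ⊗ b p ⊕_) (trans (sym (reduced-· w r)) (eq r)) ⟩
      a ⊗ d ⊗ b p ⊕ d ⊗ (α ⊗ b r ⊕ ⊖ b p ⊗ a)
        ≡⟨ cancel a d (b p) α (b r) ⟩
      d ⊗ α ⊗ b r ∎
      where
      open ≡-Reasoning
      a = M r zero
      commute : ∀ m α w → m ⊗ (α ⊗ w) ≡ α ⊗ (m ⊗ w)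
      commute = solve-∀ almostRing
      rearrange : ∀ a d b′ t′ α t → a ⊗ (d ⊗ b′ ⊕ ⊖ t′) ⊕ α ⊗ t ≡ a ⊗ d ⊗ b′ ⊕ (α ⊗ t ⊕ ⊖ a ⊗ t′)
      rearrange = solve-∀ almostRing
      cancel : ∀ a d b′ α b → a ⊗ d ⊗ b′ ⊕ d ⊗ (α ⊗ b ⊕ ⊖ b′ ⊗ a) ≡ d ⊗ α ⊗ b
      cancel = solve-∀ almostRing

  -- The Fredholm alternative, by elimination of one column at a time. With no columns left, a
  -- nonzero coordinate of `b` is itself the obstruction; obstructions to the reduced system are
  -- pulled back along `reduce`.
  solvable-or-obstructed : ∀ v (M : Matrix u v) b → Solvable M b ⊎ Obstructed M b
  solvable-or-obstructed zero M b with zero? b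
  ... | inj₁ b≡0       = inj₁ (1ᵍ , (λ ()) , (λ ()) , λ r → sym (trans (*-identityˡ (b r)) (b≡0 r)))
  ... | inj₂ (r , b≢0) = inj₂ (evalAt r , (λ ()) , b≢0)
  solvable-or-obstructed (suc v) M b with zero? (column M zero)
  ... | inj₁ a≡0 = ⊎.map extend
          (λ (φ , kills , φb≢0) → φ , (λ { zero → app-0 φ (column M zero) a≡0 ; (suc s) → kills s }) , φb≢0)
          (solvable-or-obstructed v (λ r → M r ∘ suc) b)
    where
    extend : Solvable (λ r → M r ∘ suc) b → Solvable M b
    extend (d , w , d≢0 , eq) = d , (λ { zero → 0ᵍ ; (suc s) → w s }) , d≢0 , λ r →
      trans (cong (_⊕ sumᵍ v (λ s → M r (suc s) ⊗ w s)) (zeroʳ (M r zero)))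
            (trans (+-identityˡ (sumᵍ v (λ s → M r (suc s) ⊗ w s))) (eq r))
  ... | inj₂ (p , α≢0) = ⊎.map
          (λ (d , w , d≢0 , eq) → d ⊗ α , lift b d w , ⊗≢0 d≢0 α≢0 , lift-solves b d w eq)
          (λ (φ , kills , φb≢0) → pullback φ , (λ { zero → pullback-pivot φ ; (suc s) → kills s }) , φb≢0)
          (solvable-or-obstructed v reduced (reduce b))
    where open Eliminate M p

module _ {u v : ℕ} where

  -- A local-to-global property: once the common factor `3^ k` is removed, solving the system modulo
  -- `3^ N` for `ρ` times `b`, with `ρ` prime to 3, already yields an exact solution up to a nonzero
  -- scalar.
  Lifts : Matrix u v → Vecᵍ u → ℕ → Set
  Lifts M b N = ∀ k ρ (x : Vecᵍ v) (e : Vecᵍ u) → ¬ 3∣ ρ →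
    (∀ r → (M · x) r ≡ 3^ k ⊗ (ρ ⊗ b r ⊕ 3^ N ⊗ e r)) → Solvable M b

  Lifts-mono : ∀ M b {m n} → m ≤ n → Lifts M b m → Lifts M b n
  Lifts-mono M b {m} {n} m≤n lifts k ρ x e ¬3∣ρ eq = lifts k ρ x (λ r → 3^ (n ℕ.∸ m) ⊗ e r) ¬3∣ρ λ r →
    trans (eq r) (cong (λ t → 3^ k ⊗ (ρ ⊗ b r ⊕ t)) (begin
      3^ n ⊗ e r                        ≡⟨ cong (λ n → 3^ n ⊗ e r) (ℕ.m+[n∸m]≡n m≤n) ⟨
      3^ (m ℕ.+ (n ℕ.∸ m)) ⊗ e r        ≡⟨ cong (_⊗ e r) (3^-+ m (n ℕ.∸ m)) ⟩
      3^ m ⊗ 3^ (n ℕ.∸ m) ⊗ e r         ≡⟨ *-assoc (3^ m) (3^ (n ℕ.∸ m)) (e r) ⟩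
      3^ m ⊗ (3^ (n ℕ.∸ m) ⊗ e r)       ∎))
    where open ≡-Reasoning

  -- A functional φ that kills the columns but not b has φ b exactly divisible by some 3ⁿ, which
  -- rules out solutions modulo 3ⁿ⁺¹.
  lifts : ∀ M b → ∃ (Lifts M b)
  lifts M b with solvable-or-obstructed v M b
  ... | inj₁ solvable = 0 , λ _ _ _ _ _ _ → solvable
  ... | inj₂ (φ , kills , φb≢0) with factor (app φ b)
  ...   | inj₁ φb≡0 = contradiction φb≡0 φb≢0
  ...   | inj₂ (n , β , φb≡ , ¬3∣β) = suc n , λ k ρ x e ¬3∣ρ eq →
    contradiction (3-prime ρ β (impossible k ρ x e eq)) [ ¬3∣ρ , ¬3∣β ]′
    where
    open ≡-Reasoning
    expand : ∀ k ρ b t e → k ⊗ (ρ ⊗ b ⊕ t ⊗ e) ≡ (k ⊗ ρ) ⊗ b ⊕ (k ⊗ t) ⊗ e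
    expand = solve-∀ almostRing
    collect : ∀ k ρ n β e → (k ⊗ ρ) ⊗ (n ⊗ β) ⊕ (k ⊗ (3ᵍ ⊗ n)) ⊗ e ≡ k ⊗ n ⊗ (ρ ⊗ β ⊕ 3ᵍ ⊗ e)
    collect = solve-∀ almostRing
    isolate : ∀ p e → p ≡ (p ⊕ 3ᵍ ⊗ e) ⊕ 3ᵍ ⊗ (⊖ e)
    isolate = solve-∀ almostRing
    impossible : ∀ k ρ x e → (∀ r → (M · x) r ≡ 3^ k ⊗ (ρ ⊗ b r ⊕ 3^ suc n ⊗ e r)) → 3∣ ρ ⊗ β
    -- Applying `φ` to the equation kills the left side; cancelling `3^ k` and `3^ n` leaves
    -- `ρ ⊗ β ⊕ 3ᵍ ⊗ app φ e ≡ 0ᵍ`, whence the witness.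
    impossible k ρ x e eq = ⊖ app φ e , (begin
      ρ ⊗ β                                             ≡⟨ isolate (ρ ⊗ β) (app φ e) ⟩
      (ρ ⊗ β ⊕ 3ᵍ ⊗ app φ e) ⊕ 3ᵍ ⊗ (⊖ app φ e)          ≡⟨ cong (_⊕ 3ᵍ ⊗ (⊖ app φ e)) vanishes ⟩
      0ᵍ ⊕ 3ᵍ ⊗ (⊖ app φ e)                             ≡⟨ +-identityˡ (3ᵍ ⊗ (⊖ app φ e)) ⟩
      3ᵍ ⊗ (⊖ app φ e)                                  ∎)
      where
      product : 3^ k ⊗ 3^ n ⊗ (ρ ⊗ β ⊕ 3ᵍ ⊗ app φ e) ≡ 0ᵍ
      product = begin
        3^ k ⊗ 3^ n ⊗ (ρ ⊗ β ⊕ 3ᵍ ⊗ app φ e)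
          ≡⟨ collect (3^ k) ρ (3^ n) β (app φ e) ⟨
        (3^ k ⊗ ρ) ⊗ (3^ n ⊗ β) ⊕ (3^ k ⊗ (3ᵍ ⊗ 3^ n)) ⊗ app φ e
          ≡⟨ cong₂ (λ s t → (3^ k ⊗ ρ) ⊗ s ⊕ (3^ k ⊗ t) ⊗ app φ e) (sym φb≡) (sym (3^-+ 1 n)) ⟩
        (3^ k ⊗ ρ) ⊗ app φ b ⊕ (3^ k ⊗ 3^ suc n) ⊗ app φ e
          ≡⟨ app-linear φ (3^ k ⊗ ρ) (3^ k ⊗ 3^ suc n) b e ⟨
        app φ (λ r → (3^ k ⊗ ρ) ⊗ b r ⊕ (3^ k ⊗ 3^ suc n) ⊗ e r)
          ≡⟨ app-cong φ (λ r → trans (eq r) (expand (3^ k) ρ (b r) (3^ suc n) (e r))) ⟨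
        app φ (M · x)
          ≡⟨ app-columns φ v M kills x ⟩
        0ᵍ ∎
      vanishes : ρ ⊗ β ⊕ 3ᵍ ⊗ app φ e ≡ 0ᵍ
      vanishes = [ (λ eq → contradiction eq (⊗≢0 (3^≢0 k) (3^≢0 n))) , id ]′
        (⊗≡0 (3^ k ⊗ 3^ n) (ρ ⊗ β ⊕ 3ᵍ ⊗ app φ e) product)

-- Position of rows relative to a level, and a common modulus

data Place : Set where
  below on above : Place

-- Rows of smaller valuation are not divisible by the power of 3 that belongs to the level;
-- multiplying them by 0 makes their equations trivial.
keep : Place → ℤ[i]
keep below = 0ᵍ
keep on    = 1ᵍ
keep above = 1ᵍ

target : Place → ℤ[i]
target below = 0ᵍ
target on    = 1ᵍ
target above = 0ᵍ

-- There are finitely many place vectors; splitting on the first entry gives three bounds, and their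
-- sum dominates each.
common-bound : ∀ n (P : Vec Place n → ℕ → Set) → (∀ σ {j k} → j ≤ k → P σ j → P σ k) →
  (∀ σ → ∃ (P σ)) → ∃ λ N → ∀ σ → P σ N
common-bound zero    P mono bound = map₂ (λ p → λ { [] → p }) (bound [])
common-bound (suc n) P mono bound with
  common-bound n (P ∘ (below ∷_)) (mono ∘ (below ∷_)) (bound ∘ (below ∷_)) |
  common-bound n (P ∘ (on ∷_)) (mono ∘ (on ∷_)) (bound ∘ (on ∷_)) |
  common-bound n (P ∘ (above ∷_)) (mono ∘ (above ∷_)) (bound ∘ (above ∷_))
... | j , p | k , q | l , r = j ℕ.+ k ℕ.+ l , λ where
  (below ∷ σ) → mono _ (ℕ.≤-trans (ℕ.m≤m+n j k) (ℕ.m≤m+n (j ℕ.+ k) l)) (p σ)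
  (on ∷ σ)    → mono _ (ℕ.≤-trans (ℕ.m≤n+m k j) (ℕ.m≤m+n (j ℕ.+ k) l)) (q σ)
  (above ∷ σ) → mono _ (ℕ.m≤n+m l (j ℕ.+ k)) (r σ)

masked : ∀ {u v} → Matrix u v → Vec Place u → Matrix u v
masked A σ r s = keep (lookup σ r) ⊗ A r s

masked-· : ∀ {u v} (A : Matrix u v) σ x r → (masked A σ · x) r ≡ keep (lookup σ r) ⊗ (A · x) r
masked-· {u} {v} A σ x r = trans
  (sum-cong v λ s → *-assoc (keep (lookup σ r)) (A r s) (x s))
  (sum-⊗ v (keep (lookup σ r)) λ s → A r s ⊗ x s)

-- The modulus has to be fixed before the colouring, hence before the levels are known, so a single
-- `N` must serve every possible placement of the rows.
masked-lifts : ∀ {u v} (A : Matrix u v) → ∃ λ N → ∀ σ → Lifts (masked A σ) (target ∘ lookup σ) N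
masked-lifts {u} A = common-bound u
  (λ σ → Lifts (masked A σ) (target ∘ lookup σ))
  (λ σ → Lifts-mono (masked A σ) (target ∘ lookup σ))
  (λ σ → lifts (masked A σ) (target ∘ lookup σ))

-- The colouring and the layers it produces

-- Opaque, since conversion checking would otherwise unfold the recursion in factor.
-- At 0 the values are junk.
abstract
  val : ℤ[i] → ℕ
  val z = [ (λ _ → 0) , proj₁ ]′ (factor z)

  unit : ℤ[i] → ℤ[i]
  unit z = [ (λ _ → 1ᵍ) , proj₁ ∘ proj₂ ]′ (factor z)

  val-unit : ∀ z → z ≢ 0ᵍ → z ≡ 3^ val z ⊗ unit z × ¬ 3∣ unit z
  val-unit z z≢0 with factor z
  ... | inj₁ z≡0              = contradiction z≡0 z≢0
  ... | inj₂ (k , y , factored) = factored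

-- With equal remainders the strict inequality passes to the quotients, so the gap contains at least
-- one full `N`.
congruent-gap : ∀ N .{{_ : NonZero N}} {j k} → j < k → j ℕ.% N ≡ k ℕ.% N → ∃ λ t → k ≡ j ℕ.+ (N ℕ.+ t)
congruent-gap N {j} {k} j<k eq = d ℕ.* N , (begin
    k                                            ≡⟨ ℕ.m≡m%n+[m/n]*n k N ⟩
    k ℕ.% N ℕ.+ q′ ℕ.* N                         ≡⟨ cong₂ (λ r p → r ℕ.+ p ℕ.* N) (sym eq) (sym sq+d≡q′) ⟩
    j ℕ.% N ℕ.+ (suc q ℕ.+ d) ℕ.* N              ≡⟨ cong (j ℕ.% N ℕ.+_) (ℕ.*-distribʳ-+ N (suc q) d) ⟩
    j ℕ.% N ℕ.+ (N ℕ.+ q ℕ.* N ℕ.+ d ℕ.* N)      ≡⟨ cong (λ t → j ℕ.% N ℕ.+ (t ℕ.+ d ℕ.* N)) (ℕ.+-comm N (q ℕ.* N)) ⟩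
    j ℕ.% N ℕ.+ (q ℕ.* N ℕ.+ N ℕ.+ d ℕ.* N)      ≡⟨ cong (j ℕ.% N ℕ.+_) (ℕ.+-assoc (q ℕ.* N) N (d ℕ.* N)) ⟩
    j ℕ.% N ℕ.+ (q ℕ.* N ℕ.+ (N ℕ.+ d ℕ.* N))    ≡⟨ ℕ.+-assoc (j ℕ.% N) (q ℕ.* N) _ ⟨
    j ℕ.% N ℕ.+ q ℕ.* N ℕ.+ (N ℕ.+ d ℕ.* N)      ≡⟨ cong (ℕ._+ (N ℕ.+ d ℕ.* N)) (ℕ.m≡m%n+[m/n]*n j N) ⟨
    j ℕ.+ (N ℕ.+ d ℕ.* N)                        ∎)
  where
  open ≡-Reasoning
  q  = j ℕ./ N
  q′ = k ℕ./ N
  q<q′ : q < q′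
  q<q′ = ℕ.≰⇒> λ q′≤q → ℕ.<⇒≱ j<k (subst₂ _≤_ (sym (ℕ.m≡m%n+[m/n]*n k N)) (sym (ℕ.m≡m%n+[m/n]*n j N))
    (ℕ.+-mono-≤ (ℕ.≤-reflexive (sym eq)) (ℕ.*-monoˡ-≤ N q′≤q)))
  d : ℕ
  d = q′ ℕ.∸ suc q
  sq+d≡q′ : suc q ℕ.+ d ≡ q′
  sq+d≡q′ = ℕ.m+[n∸m]≡n q<q′

-- Rows with smaller `k` are left free: the descent reaches them only after a multiple of `w` has
-- been added.
Layer : ∀ {u v} → Matrix u v → (Fin u → ℕ) → Fin u → Set
Layer {u} {v} A k r = ∃₂ λ (d : ℤ[i]) (w : Vecᵍ v) → d ≢ 0ᵍ ×
  (∀ q → k q ≡ k r → (A · w) q ≡ d) × (∀ q → k r < k q → (A · w) q ≡ 0ᵍ)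

place : ∀ {j k} → Tri (j < k) (j ≡ k) (k < j) → Place
place (tri< _ _ _) = below
place (tri≈ _ _ _) = on
place (tri> _ _ _) = above

place-on : ∀ {j k} (c : Tri (j < k) (j ≡ k) (k < j)) → j ≡ k → place c ≡ on
place-on (tri< _ j≢k _) j≡k = contradiction j≡k j≢k
place-on (tri≈ _ _   _) j≡k = refl
place-on (tri> _ j≢k _) j≡k = contradiction j≡k j≢k

place-above : ∀ {j k} (c : Tri (j < k) (j ≡ k) (k < j)) → k < j → place c ≡ above
place-above (tri< _ _ k≮j) k<j = contradiction k<j k≮j
place-above (tri≈ _ _ k≮j) k<j = contradiction k<j k≮j
place-above (tri> _ _ _)   k<j = refl

module _ (N : ℕ) .{{_ : NonZero N}} where

  private
    Q : ℕ
    Q = 3 ℕ.^ N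

    instance
      Q≢0 : NonZero Q
      Q≢0 = ℕ.m^n≢0 3 N

  colour : ℤ[i] → Fin (N ℕ.* (Q ℕ.* Q))
  colour z = combine (val z ℕ.mod N) (residueClass Q (unit z))

  same-colour : ∀ {y z} → colour y ≡ colour z →
    val y ℕ.% N ≡ val z ℕ.% N × residue Q (unit y) ≡ residue Q (unit z)
  same-colour {y} {z} eq =
    let val-eq , unit-eq = Fin.combine-injective (val y ℕ.mod N) _ (val z ℕ.mod N) _ eq
    in Fin.fromℕ<-injective _ _ (ℕ.m%n<n (val y) N) (ℕ.m%n<n (val z) N) val-eq
     , residueClass⇒residue Q {unit y} {unit z} unit-eq

  -- Below, both sides are 0. On the level, the two units agree modulo `3^ N` and the difference of
  -- their quotients goes into `e`. Above, the valuation is larger by at least `N`, so the whole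
  -- entry is absorbed by `e`.
  expansion : ∀ y z (c : Tri (val z < val y) (val z ≡ val y) (val y < val z)) →
    z ≢ 0ᵍ → colour y ≡ colour z →
    ∃ λ e → keep (place c) ⊗ z ≡ 3^ val y ⊗ (unit y ⊗ target (place c) ⊕ 3^ N ⊗ e)
  expansion y z (tri< _ _ _) z≢0 eq = 0ᵍ , collapse z (3^ val y) (unit y) (3^ N)
    where
    collapse : ∀ z k ρ t → 0ᵍ ⊗ z ≡ k ⊗ (ρ ⊗ 0ᵍ ⊕ t ⊗ 0ᵍ)
    collapse = solve-∀ almostRing
  expansion y z (tri≈ _ v≡ _) z≢0 eq = quotient Q (unit z) ⊕ ⊖ quotient Q (unit y) , (begin
    1ᵍ ⊗ z
      ≡⟨ *-identityˡ z ⟩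
    z
      ≡⟨ proj₁ (val-unit z z≢0) ⟩
    3^ val z ⊗ unit z
      ≡⟨ cong₂ (λ k t → 3^ k ⊗ t) v≡ (residue-quotient Q (unit z)) ⟩
    3^ val y ⊗ (residue Q (unit z) ⊕ 3^ N ⊗ quotient Q (unit z))
      ≡⟨ rearrange (3^ val y) (residue Q (unit z)) (3^ N) (quotient Q (unit z)) (quotient Q (unit y)) ⟩
    3^ val y ⊗ ((residue Q (unit z) ⊕ 3^ N ⊗ quotient Q (unit y)) ⊗ 1ᵍ
                 ⊕ 3^ N ⊗ (quotient Q (unit z) ⊕ ⊖ quotient Q (unit y)))
      ≡⟨ cong (λ ρ → 3^ val y ⊗ (ρ ⊗ 1ᵍ ⊕ 3^ N ⊗ (quotient Q (unit z) ⊕ ⊖ quotient Q (unit y))))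
           (trans (cong (_⊕ 3^ N ⊗ quotient Q (unit y)) (sym (proj₂ (same-colour {y} {z} eq))))
                  (sym (residue-quotient Q (unit y)))) ⟩
    3^ val y ⊗ (unit y ⊗ 1ᵍ ⊕ 3^ N ⊗ (quotient Q (unit z) ⊕ ⊖ quotient Q (unit y)))
      ∎)
    where
    open ≡-Reasoning
    rearrange : ∀ k r t p q → k ⊗ (r ⊕ t ⊗ p) ≡ k ⊗ ((r ⊕ t ⊗ q) ⊗ 1ᵍ ⊕ t ⊗ (p ⊕ ⊖ q))
    rearrange = solve-∀ almostRing
  expansion y z (tri> _ _ v<) z≢0 eq with congruent-gap N v< (proj₁ (same-colour {y} {z} eq))
  ... | t , v≡ = 3^ t ⊗ unit z , (begin
    1ᵍ ⊗ z
      ≡⟨ *-identityˡ z ⟩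
    z
      ≡⟨ proj₁ (val-unit z z≢0) ⟩
    3^ val z ⊗ unit z
      ≡⟨ cong (λ k → 3^ k ⊗ unit z) v≡ ⟩
    3^ (val y ℕ.+ (N ℕ.+ t)) ⊗ unit z
      ≡⟨ cong (_⊗ unit z) (trans (3^-+ (val y) (N ℕ.+ t)) (cong (3^ val y ⊗_) (3^-+ N t))) ⟩
    3^ val y ⊗ (3^ N ⊗ 3^ t) ⊗ unit z
      ≡⟨ rearrange (3^ val y) (unit y) (3^ N) (3^ t) (unit z) ⟩
    3^ val y ⊗ (unit y ⊗ 0ᵍ ⊕ 3^ N ⊗ (3^ t ⊗ unit z))
      ∎)
    where
    open ≡-Reasoning
    rearrange : ∀ k ρ n t z → k ⊗ (n ⊗ t) ⊗ z ≡ k ⊗ (ρ ⊗ 0ᵍ ⊕ n ⊗ (t ⊗ z))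
    rearrange = solve-∀ almostRing

  -- The levels are the valuations of a monochromatic image `y`. For each row `r` the same `x`
  -- solves the masked system modulo `3^ N`, with the unit part of `y r` as `ρ`; lifting makes this
  -- exact.
  layers-if-lifts : ∀ {u v} (A : Matrix u v) → ImagePartitionRegular A → (∀ σ → Lifts (masked A σ) (target ∘ lookup σ) N) →
    ∃ λ (k : Fin u → ℕ) → ∀ r → Layer A k r
  layers-if-lifts {u} A ipr lifts with ipr _ colour
  ... | j , x , _ , mono = k , layer
    where
    y : Vecᵍ u
    y = A · x

    y≢0 : ∀ r → y r ≢ 0ᵍ
    y≢0 = proj₁ ∘ mono

    k : Fin u → ℕ
    k = val ∘ y

    layer : ∀ r → Layer A k r
    layer r = convert (lifts σ (k r) (unit (y r)) x (proj₁ ∘ expand) (proj₂ (val-unit (y r) (y≢0 r)))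
        λ q → trans (masked-· A σ x q) (proj₂ (expand q)))
      where
      at : ∀ q → Place
      at q = place (ℕ.<-cmp (k q) (k r))

      σ : Vec Place u
      σ = tabulate at

      expand : ∀ q → ∃ λ e → keep (lookup σ q) ⊗ y q ≡ 3^ k r ⊗ (unit (y r) ⊗ target (lookup σ q) ⊕ 3^ N ⊗ e)
      expand q = subst (λ p → ∃ λ e → keep p ⊗ y q ≡ 3^ k r ⊗ (unit (y r) ⊗ target p ⊕ 3^ N ⊗ e))
        (sym (lookup∘tabulate at q))
        (expansion (y r) (y q) (ℕ.<-cmp (k q) (k r)) (y≢0 q) (trans (proj₂ (mono r)) (sym (proj₂ (mono q)))))

      convert : Solvable (masked A σ) (target ∘ lookup σ) → Layer A k r
      convert (d , w , d≢0 , eq) = d , w , d≢0 , on-level , above-level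
        where
        eq′ : ∀ q {p} → at q ≡ p → keep p ⊗ (A · w) q ≡ d ⊗ target p
        eq′ q at≡p = subst (λ p → keep p ⊗ (A · w) q ≡ d ⊗ target p) (trans (lookup∘tabulate at q) at≡p)
          (trans (sym (masked-· A σ w q)) (eq q))

        on-level : ∀ q → k q ≡ k r → (A · w) q ≡ d
        on-level q k≡ = trans (sym (*-identityˡ ((A · w) q)))
          (trans (eq′ q (place-on (ℕ.<-cmp (k q) (k r)) k≡)) (trans (*-comm d 1ᵍ) (*-identityˡ d)))

        above-level : ∀ q → k r < k q → (A · w) q ≡ 0ᵍ
        above-level q k< = trans (sym (*-identityˡ ((A · w) q)))
          (trans (eq′ q (place-above (ℕ.<-cmp (k q) (k r)) k<)) (zeroʳ d))

layered : ∀ {u v} (A : Matrix u v) → ImagePartitionRegular A → ∃ λ (k : Fin u → ℕ) → ∀ r → Layer A k r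
layered A ipr =
  let N , lifts = masked-lifts A
  -- The successor makes the modulus for valuations nonzero.
  in layers-if-lifts (suc N) A ipr λ σ → Lifts-mono (masked A σ) (target ∘ lookup σ) (ℕ.n≤1+n N) (lifts σ)

-- Thick sets

-- The two points differ by `L + L + 1` in the real part, and a real part is bounded by the norm, so
-- both norms cannot be at most `L`.
far-or-shifted-far : ∀ L q → L < norm (0ᵍ ⊕ q) ⊎ L < norm (⟦ + suc (L ℕ.+ L) ⟧ ⊕ q)
far-or-shifted-far L q with L ℕ.<? norm (0ᵍ ⊕ q) | L ℕ.<? norm (⟦ + suc (L ℕ.+ L) ⟧ ⊕ q)
... | yes far | _       = inj₁ far
... | no  _   | yes far = inj₂ far
... | no near | no near′ = contradiction (begin
  suc (L ℕ.+ L)                                     ≡⟨ cong ∣_∣ (shift (+ suc (L ℕ.+ L)) (re q)) ⟩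
  ∣ re (⟦ + suc (L ℕ.+ L) ⟧ ⊕ q) ℤ.- re (0ᵍ ⊕ q) ∣    ≤⟨ ℤ.∣i-j∣≤∣i∣+∣j∣ (re (⟦ + suc (L ℕ.+ L) ⟧ ⊕ q)) (re (0ᵍ ⊕ q)) ⟩
  ∣ re (⟦ + suc (L ℕ.+ L) ⟧ ⊕ q) ∣ ℕ.+ ∣ re (0ᵍ ⊕ q) ∣ ≤⟨ ℕ.+-mono-≤ (∣re∣≤norm (⟦ + suc (L ℕ.+ L) ⟧ ⊕ q)) (∣re∣≤norm (0ᵍ ⊕ q)) ⟩
  norm (⟦ + suc (L ℕ.+ L) ⟧ ⊕ q) ℕ.+ norm (0ᵍ ⊕ q)    ≤⟨ ℕ.+-mono-≤ (ℕ.≮⇒≥ near′) (ℕ.≮⇒≥ near) ⟩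
  L ℕ.+ L                                           ∎) ℕ.1+n≰n
  where
  open ℕ.≤-Reasoning
  shift : ∀ K a → K ≡ (K ℤ.+ a) ℤ.- (+ 0 ℤ.+ a)
  shift = ℤ-Ring.solve-∀

residues : ℕ → List ℤ[i]
residues n = cartesianProductWith (λ a b → (+ a) + (+ b) i) (upTo n) (upTo n)

residue∈residues : ∀ n .{{_ : NonZero n}} z → residue n z ∈ residues n
residue∈residues n z = ∈-cartesianProductWith⁺ (λ a b → (+ a) + (+ b) i)
  (∈-upTo⁺ (ℤ.n%ℕd<d (re z) n)) (∈-upTo⁺ (ℤ.n%ℕd<d (im z) n))

module _ {C : ℤ[i] → Set} (thick : Thick _+ᵍ_ C) (G : List ℤ[i]) where

  -- Translating by -ρ for every residue ρ corrects the point found by thickness to a multiple of n.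
  thick-multiple : ∀ n .{{_ : NonZero n}} κs → ∃ λ q → ∀ {κ g} → κ ∈ κs → g ∈ G → C (g ⊕ (κ ⊕ q) ⊗ ⟦ + n ⟧)
  thick-multiple n κs = quotient n x , λ {κ} {g} κ∈ g∈ → subst C (correct g κ)
    (All.lookup in-C (there (∈-cartesianProductWith⁺ _⊕_ g∈
      (∈-cartesianProductWith⁺ correction κ∈ (residue∈residues n x)))))
    where
    correction : ℤ[i] → ℤ[i] → ℤ[i]
    correction κ ρ = ⟦ + n ⟧ ⊗ κ ⊕ ⊖ ρ
    translates : List ℤ[i]
    -- The leading `0ᵍ` keeps the list nonempty, as thickness demands, even when `G` is empty.
    translates = 0ᵍ ∷ cartesianProductWith _⊕_ G (cartesianProductWith correction κs (residues n))
    x : ℤ[i]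
    x = proj₁ (thick translates (λ ()))
    in-C : All (λ f → C (f ⊕ x)) translates
    in-C = proj₂ (thick translates (λ ()))
    rearrange : ∀ g n κ ρ q → g ⊕ (n ⊗ κ ⊕ ⊖ ρ) ⊕ (ρ ⊕ n ⊗ q) ≡ g ⊕ (κ ⊕ q) ⊗ n
    rearrange = solve-∀ almostRing
    correct : ∀ g κ → g ⊕ correction κ (residue n x) ⊕ x ≡ g ⊕ (κ ⊕ quotient n x) ⊗ ⟦ + n ⟧
    correct g κ = trans (cong (g ⊕ correction κ (residue n x) ⊕_) (residue-quotient n x))
      (rearrange g ⟦ + n ⟧ κ (residue n x) (quotient n x))

  -- Multiples `q` of `norm d` are multiples `q ⊗ conj d` of `d`, and the factor `conj d` does not
  -- lower the norm. Asking for both shifts 0 and `K` at once guarantees that one of them is large.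
  thick-large-multiple : ∀ {d} → d ≢ 0ᵍ → ∀ L → ∃ λ m → L < norm m × (∀ {g} → g ∈ G → C (g ⊕ m ⊗ d))
  thick-large-multiple {d} d≢0 L = finish (thick-multiple n (0ᵍ ∷ K ∷ []))
    where
    n : ℕ
    n = norm d
    instance
      n≢0 : NonZero n
      n≢0 = ℕ.>-nonZero (0<norm d d≢0)
    K : ℤ[i]
    K = ⟦ + suc (L ℕ.+ L) ⟧
    conj≢0 : conj d ≢ 0ᵍ
    conj≢0 eq = ℕ.≢-nonZero⁻¹ n (ℤ.+-injective (cong re (trans (sym (conj-⊗ d)) (trans (cong (_⊗ d) eq) (zeroˡ d)))))
    large : ∀ q → norm q ≤ norm (q ⊗ conj d)
    large q = subst (norm q ≤_) (sym (norm-⊗ q (conj d)))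
      (ℕ.m≤m*n (norm q) (norm (conj d)) {{ℕ.>-nonZero (0<norm (conj d) conj≢0)}})
    scale : ∀ q → L < norm q → (∀ {g} → g ∈ G → C (g ⊕ q ⊗ ⟦ + n ⟧)) →
      ∃ λ m → L < norm m × (∀ {g} → g ∈ G → C (g ⊕ m ⊗ d))
    scale q far in-C = q ⊗ conj d , ℕ.<-≤-trans far (large q) , λ {g} g∈ →
      subst (λ t → C (g ⊕ t)) (trans (cong (q ⊗_) (sym (conj-⊗ d))) (sym (*-assoc q (conj d) d))) (in-C g∈)
    finish : (∃ λ q → ∀ {κ g} → κ ∈ 0ᵍ ∷ K ∷ [] → g ∈ G → C (g ⊕ (κ ⊕ q) ⊗ ⟦ + n ⟧)) →
      ∃ λ m → L < norm m × (∀ {g} → g ∈ G → C (g ⊕ m ⊗ d))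
    finish (q , in-C) with far-or-shifted-far L q
    ... | inj₁ far = scale (0ᵍ ⊕ q) far (in-C (here refl))
    ... | inj₂ far = scale (K ⊕ q) far (in-C (there (here refl)))

⊕≢0 : ∀ p m → norm p < norm m → p ⊕ m ≢ 0ᵍ
⊕≢0 p m p<m eq = ℕ.<⇒≢ p<m (trans (cong norm p≡⊖m) (norm-⊖ m))
  where
  cancel : ∀ p m → p ≡ p ⊕ m ⊕ ⊖ m
  cancel = solve-∀ almostRing
  p≡⊖m : p ≡ ⊖ m
  p≡⊖m = trans (cancel p m) (trans (cong (_⊕ ⊖ m) eq) (+-identityˡ (⊖ m)))

-- If `w` is 0 nothing changes; otherwise `m ⊗ w` has norm at least that of `m` and cannot cancel
-- `p`.
⊕-⊗≢0 : ∀ p m w → p ≢ 0ᵍ → norm p < norm m → p ⊕ m ⊗ w ≢ 0ᵍ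
⊕-⊗≢0 p m w p≢0 p<m with w ≟ᵍ 0ᵍ
... | yes refl = p≢0 ∘ trans (simplify p m)
  where
  simplify : ∀ p m → p ≡ p ⊕ m ⊗ 0ᵍ
  simplify = solve-∀ almostRing
... | no w≢0 = ⊕≢0 p (m ⊗ w) (ℕ.<-≤-trans p<m (subst (norm m ≤_) (sym (norm-⊗ m w))
  (ℕ.m≤m*n (norm m) (norm w) {{ℕ.>-nonZero (0<norm w w≢0)}})))

norm-bound : (ps : List ℤ[i]) → ∃ λ L → ∀ {p} → p ∈ ps → norm p ≤ L
norm-bound ps = List.max 0 (map norm ps) , λ p∈ → All.lookup (List.xs≤max 0 (map norm ps)) (∈-map⁺ norm p∈)

·-⊕-⊗ : ∀ {u v} (A : Matrix u v) (y x w : Vecᵍ v) m r →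
  (A · (y +ᵛ (λ s → x s ⊕ m ⊗ w s))) r ≡ (A · (y +ᵛ x)) r ⊕ m ⊗ (A · w) r
·-⊕-⊗ {v = v} A y x w m r = begin
  sumᵍ v (λ s → A r s ⊗ (y s ⊕ (x s ⊕ m ⊗ w s)))
    ≡⟨ sum-cong v (λ s → rearrange (A r s) (y s) (x s) m (w s)) ⟩
  sumᵍ v (λ s → 1ᵍ ⊗ (A r s ⊗ (y s ⊕ x s)) ⊕ m ⊗ (A r s ⊗ w s))
    ≡⟨ sum-linear v (λ s → A r s ⊗ (y s ⊕ x s)) (λ s → A r s ⊗ w s) 1ᵍ m ⟩
  1ᵍ ⊗ (A · (y +ᵛ x)) r ⊕ m ⊗ (A · w) r
    ≡⟨ cong (_⊕ m ⊗ (A · w) r) (*-identityˡ ((A · (y +ᵛ x)) r)) ⟩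
  (A · (y +ᵛ x)) r ⊕ m ⊗ (A · w) r ∎
  where
  open ≡-Reasoning
  rearrange : ∀ a y x m w → a ⊗ (y ⊕ (x ⊕ m ⊗ w)) ≡ 1ᵍ ⊗ (a ⊗ (y ⊕ x)) ⊕ m ⊗ (a ⊗ w)
  rearrange = solve-∀ almostRing

-- Descent through the levels

bounded : ∀ {u} (k : Fin u → ℕ) → ∃ λ H → ∀ r → k r < H
bounded {u} k = suc (List.max 0 (map k (allFin u))) , λ r →
  s≤s (All.lookup (List.xs≤max 0 (map k (allFin u))) (∈-map⁺ k (∈-allFin r)))

module _ {u v} (A : Matrix u v) (k : Fin u → ℕ) (layers : ∀ r → Layer A k r)
  {C : ℤ[i] → Set} (thick : Thick _+ᵍ_ C) (F : List (Vecᵍ v)) where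

  -- The invariant of the descent: one translate `x` serves all of `F`, and the rows of level at
  -- least `h` are already settled.
  Reaches : ℕ → Vecᵍ v → Set
  Reaches h x = ∀ {f} → f ∈ F → (∀ s → (f +ᵛ x) s ≢ 0ᵍ) × (∀ r → h ≤ k r → C ((A · (f +ᵛ x)) r))

  private
    values : ∀ {n} → (Vecᵍ v → Fin n → ℤ[i]) → List ℤ[i]
    values {n} g = cartesianProductWith g F (allFin n)

    ∈-values : ∀ {n} (g : Vecᵍ v → Fin n → ℤ[i]) {f} → f ∈ F → ∀ s → g f s ∈ values g
    ∈-values g f∈F s = ∈-cartesianProductWith⁺ g f∈F (∈-allFin s)

  -- Above all levels there is no condition on rows, and a constant vector larger than every entry
  -- of `F` keeps the coordinates nonzero.
  start : ∃₂ Reaches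
  start with bounded k | norm-bound (values λ f → f)
  ... | H , k<H | L , norm≤L = H , (λ _ → ⟦ + suc L ⟧) , λ {f} f∈F →
    (λ s → ⊕≢0 (f s) ⟦ + suc L ⟧
      (ℕ.<-≤-trans (s≤s (norm≤L (∈-values (λ f → f) f∈F s))) (∣re∣≤norm ⟦ + suc L ⟧))) ,
    (λ r H≤k → contradiction H≤k (ℕ.<⇒≱ (k<H r)))

  -- Adding `m` times `w` leaves the higher rows unchanged and moves every row of the level by the
  -- same `m ⊗ d`. Thickness supplies one `m` for all these rows and all of `F`, with norm beyond
  -- every present coordinate.
  add-layer : ∀ {p x} → Reaches (suc (k p)) x → Layer A k p → ∃ (Reaches (k p))
  add-layer {p} {x} reaches (d , w , d≢0 , on-level , above-level) =
    let L , norm≤L = norm-bound (values λ f → f +ᵛ x)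
        m , L<m , in-C = thick-large-multiple {C} thick (values λ f → A · (f +ᵛ x)) d≢0 L
    in (λ s → x s ⊕ m ⊗ w s) , λ {f} f∈F →
         (λ s → subst (_≢ 0ᵍ) (+-assoc (f s) (x s) (m ⊗ w s))
           (⊕-⊗≢0 (f s ⊕ x s) m (w s) (proj₁ (reaches f∈F) s)
             (ℕ.≤-<-trans (norm≤L (∈-values (λ f → f +ᵛ x) f∈F s)) L<m)))
       , (λ r → rows f m r (proj₂ (reaches f∈F) r) (in-C (∈-values (λ f → A · (f +ᵛ x)) f∈F r)))
    where
    rows : ∀ f m r → (k p < k r → C ((A · (f +ᵛ x)) r)) → C ((A · (f +ᵛ x)) r ⊕ m ⊗ d) →
      k p ≤ k r → C ((A · (f +ᵛ λ s → x s ⊕ m ⊗ w s)) r)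
    rows f m r old new kp≤kr = subst C (sym (·-⊕-⊗ A f x w m r)) (go (ℕ.m≤n⇒m<n∨m≡n kp≤kr))
      where
      a : ℤ[i]
      a = (A · (f +ᵛ x)) r
      simplify : ∀ a m → a ≡ a ⊕ m ⊗ 0ᵍ
      simplify = solve-∀ almostRing
      go : k p < k r ⊎ k p ≡ k r → C (a ⊕ m ⊗ (A · w) r)
      go (inj₁ kp<kr) = subst C (trans (simplify a m) (cong (λ t → a ⊕ m ⊗ t) (sym (above-level r kp<kr)))) (old kp<kr)
      go (inj₂ kp≡kr) = subst (λ t → C (a ⊕ m ⊗ t)) (sym (on-level r (sym kp≡kr))) new

  descend : ∀ {h x} → Reaches (suc h) x → ∃ (Reaches h)
  descend {h} {x} reaches with Fin.any? (λ r → k r ℕ.≟ h)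
  ... | yes (p , refl) = add-layer {p} {x} reaches (layers p)
  -- No row lies on level `h`, so the same translate already works.
  ... | no  none       = x , λ f∈F →
    map₂ (λ in-C r h≤k → in-C r (ℕ.≤∧≢⇒< h≤k λ h≡k → none (r , sym h≡k))) (reaches f∈F)

  reach-all : ∀ h x → Reaches h x → ∃ (Reaches 0)
  reach-all zero    x reaches = x , reaches
  reach-all (suc h) x reaches = let x′ , reaches′ = descend {h} {x} reaches in reach-all h x′ reaches′

theorem2p10 : (u v : ℕ) (A : Matrix u v) → ImagePartitionRegular A →
    (C : ℤ[i] → Set) → Thick _+ᵍ_ C →
    Thick (_+ᵛ_ {v}) (λ z → (∀ s → z s ≢ 0ᵍ) × (∀ r → C ((A · z) r)))
theorem2p10 u v A ipr C thick F _ =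
  let k , layers      = layered A ipr
      h , x , reaches = start A k layers {C} thick F
      z , reaches₀    = reach-all A k layers {C} thick F h x reaches
  in z , All.tabulate λ f∈F → map₂ (λ in-C r → in-C r z≤n) (reaches₀ f∈F)
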